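{- Let $k\ge1$ be an integer. We have $$N^{(k-1)(k-2)\cdots1k}_{12\text{ - }3}(n)=\binom{n-1}{k-1}B_{n-k}.$$
   Context: A permutation $\pi=\pi_1\cdots\pi_n$ of $\{1,\dots,n\}$ contains the generalized pattern $12\text{ - }3$ if there are indices $i,j$ with $i+1<j\le n$ such that $\pi_i\pi_{i+1}\pi_j$ is order-isomorphic to $123$; otherwise it avoids it. A permutation $\pi$ begins with a pattern $p=p_1\cdots p_k$ if $n\ge k$ and $\pi_1\cdots\pi_k$ is order-isomorphic to $p$; in addition, by convention, the empty permutation is assumed to begin with the pattern $1$. The pattern $(k-1)(k-2)\cdots1k$ consists of the letters $k-1,k-2,\dots,1$ in decreasing order followed by $k$ (for $k=1$ it is $1$, for $k=2$ it is $12$). $N^p_q(n)$ is the number of permutations of $\{1,\dots,n\}$ that avoid $q$ and begin with $p$. $B_m$ is the $m$th Bell number ($B_0=1$).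
   Formalization: The formal theorem assumes k ≥ 2 instead of k ≥ 1: for k = 1 every permutation begins with the pattern 1, and the formula fails, e.g. at n = 2 the left side is 2 and the right side is B_1 = 1. -}

module Defs where

open import Data.Fin using (Fin; toℕ)
import Data.Fin as Fin
open import Data.Fin.Properties using (any?; all?)
open import Data.List using (List; filter; length; upTo; cartesianProductWith)
import Data.List as List
open import Data.Nat using (ℕ; zero; suc; _+_; _*_; _≤_; _<_; _≟_; _≤?_; _<?_)
open import Data.Nat.Combinatorics using (_C_)
open import Data.Nat.Properties using (≤-irrelevant)
open import Data.Product using (_×_; _,_; ∃; uncurry)
open import Data.Vec using (Vec; []; _∷_; _∷ʳ_; lookup; truncate; tabulate; sum; head)
open import Data.Vec.Relation.Unary.AllPairs using (allPairs?)
open import Data.Vec.Relation.Unary.Unique.Propositional using (Unique)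
open import Function using (_⇔_; mk⇔; Equivalence)
open import Relation.Binary.PropositionalEquality using (_≡_; refl; subst)
open import Relation.Nullary using (¬_; Dec; yes; no)
open import Relation.Nullary.Decidable using (map′; _×-dec_; _→-dec_; ¬?)

words : List ℕ → (n : ℕ) → List (Vec ℕ n)
words letters zero    = [] List.∷ List.[]
words letters (suc n) = cartesianProductWith _∷_ letters (words letters n)

unique? : ∀ {n} (w : Vec ℕ n) → Dec (Unique w)
unique? = allPairs? (λ x y → ¬? (x ≟ y))

-- In one-line notation: a word of length n over the n letters 1,…,n is a
-- permutation exactly when its letters are distinct.
permutations : (n : ℕ) → List (Vec ℕ n)
permutations n = filter unique? (words (List.map suc (upTo n)) n)

OrderIsomorphic : ∀ {n} → Vec ℕ n → Vec ℕ n → Set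
OrderIsomorphic u v =
  ∀ i j → lookup u i < lookup u j ⇔ lookup v i < lookup v j

orderIsomorphic? : ∀ {n} (u v : Vec ℕ n) → Dec (OrderIsomorphic u v)
orderIsomorphic? u v = all? λ i → all? λ j →
  let u<? = lookup u i <? lookup u j
      v<? = lookup v i <? lookup v j
  in map′ (uncurry mk⇔) (λ e → Equivalence.to e , Equivalence.from e)
       ((u<? →-dec v<?) ×-dec (v<? →-dec u<?))

-- The index i′ is i + 1: the letters playing 1 and 2 must be adjacent.
Contains12-3 : ∀ {n} → Vec ℕ n → Set
Contains12-3 {n} π = ∃ λ (i : Fin n) → ∃ λ (i′ : Fin n) → ∃ λ (j : Fin n) →
  toℕ i′ ≡ suc (toℕ i) × i′ Fin.< j ×
  OrderIsomorphic (lookup π i ∷ lookup π i′ ∷ lookup π j ∷ []) (1 ∷ 2 ∷ 3 ∷ [])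

Avoids12-3 : ∀ {n} → Vec ℕ n → Set
Avoids12-3 π = ¬ Contains12-3 π

avoids12-3? : ∀ {n} (π : Vec ℕ n) → Dec (Avoids12-3 π)
avoids12-3? π = ¬? (any? λ i → any? λ i′ → any? λ j →
  (toℕ i′ ≟ suc (toℕ i)) ×-dec (i′ Fin.<? j) ×-dec
  orderIsomorphic? (lookup π i ∷ lookup π i′ ∷ lookup π j ∷ []) (1 ∷ 2 ∷ 3 ∷ []))

data BeginsWith : ∀ {k n} → Vec ℕ k → Vec ℕ n → Set where
  prefix : ∀ {k n} {p : Vec ℕ k} {π : Vec ℕ n} (k≤n : k ≤ n) →
           OrderIsomorphic (truncate k≤n π) p → BeginsWith p π
  -- by convention, the empty permutation begins with the pattern 1
  empty  : BeginsWith (1 ∷ []) []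

beginsWith? : ∀ {k n} (p : Vec ℕ k) (π : Vec ℕ n) → Dec (BeginsWith p π)
beginsWith? {k} {n} p π with k ≤? n
beginsWith? p π | yes k≤n =
  map′ (prefix k≤n) (back k≤n) (orderIsomorphic? (truncate k≤n π) p)
  where
  back : ∀ {k n} {p : Vec ℕ k} {π : Vec ℕ n} (k≤n : k ≤ n) →
         BeginsWith p π → OrderIsomorphic (truncate k≤n π) p
  back {p = p} {π} k≤n (prefix k≤n′ o) =
    subst (λ le → OrderIsomorphic (truncate le π) p) (≤-irrelevant k≤n′ k≤n) o
  back () empty
beginsWith? []                 π       | no k≰n = no λ { (prefix k≤n _) → k≰n k≤n }
beginsWith? (x ∷ y ∷ p)        π       | no k≰n = no λ { (prefix k≤n _) → k≰n k≤n }
beginsWith? (x ∷ [])           (_ ∷ _) | no k≰n = no λ { (prefix k≤n _) → k≰n k≤n }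
beginsWith? (x ∷ [])           []      | no k≰n with x ≟ 1
... | yes refl = yes empty
... | no x≢1   = no λ { (prefix k≤n _) → k≰n k≤n ; empty → x≢1 refl }

N12-3 : ∀ {k} → Vec ℕ k → ℕ → ℕ
N12-3 p n =
  length (filter (λ π → avoids12-3? π ×-dec beginsWith? p π) (permutations n))

descending : (m : ℕ) → Vec ℕ m
descending zero    = []
descending (suc m) = suc m ∷ descending m

-- (k−1)(k−2)⋯1k
descendingThenMax : (k : ℕ) → Vec ℕ k
descendingThenMax zero    = []
descendingThenMax (suc m) = descending m ∷ʳ suc m

-- B_m, …, B_0, by the recurrence B_{m+1} = Σ_{i=0}^{m} C(m,i) B_{m−i}; the
-- entry of bells m at index i is B_{m−i}.
bells : (m : ℕ) → Vec ℕ (suc m)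
bells zero    = 1 ∷ []
bells (suc m) = sum (tabulate λ i → (m C toℕ i) * lookup (bells m) i) ∷ bells m

bell : ℕ → ℕ
bell m = head (bells m)

{-# OPTIONS --safe #-}
-- In a permutation L x R with maximal letter x, an ascent inside L would form
-- 12-3 together with x, so the permutation avoids 12-3 iff L is descending and
-- R avoids 12-3. With m letters besides x there are thus C(m,i) B_{m−i}
-- avoiders having |L| = i: choose the set of letters of L, then arrange the
-- others. Summing over i gives the Bell recurrence. The avoiders beginning with
-- (k−1)⋯1k are precisely those with |L| = k − 1: the ascent formed by the last
-- two letters of the prefix forces its last letter to be the maximum.
module Submission where

open import Defs
open import Data.Nat using (ℕ; _*_; _∸_; _≤_)
open import Data.Nat.Combinatorics using (_C_)
open import Relation.Binary.PropositionalEquality using (_≡_)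

open import Data.Nat using (zero; suc; _+_; _<_; _>_; z≤n; s≤s; z<s)
open import Data.Nat.Combinatorics using (nCk+nC[k+1]≡[n+1]C[k+1])
open import Data.Nat.Properties
open import Data.Empty using (⊥-elim)
open import Data.Fin using (Fin; zero; suc; toℕ; fromℕ<)
import Data.Fin.Properties as Fin
open import Data.List using (List; []; _∷_; [_]; _++_; length; map; filter; upTo)
open import Data.List.Membership.Propositional using (_∈_; _∉_)
open import Data.List.Membership.Propositional.Properties
open import Data.List.Properties
  using (filter-none; length-++; length-map; ∷-injectiveˡ; ∷-injectiveʳ; ++-cancelˡ; ++-assoc)
open import Data.List.Relation.Binary.Permutation.Propositional
  using (_↭_; ↭-refl; ↭-sym; ↭-trans; prep; ↭⇒↭ₛ)
open import Data.List.Relation.Binary.Permutation.Propositional.Properties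
  using (All-resp-↭; ∈-resp-↭; ↭-length; shift; drop-mid; drop-∷; ++⁺ˡ; ↭-empty-inv; ++-identityʳ)
import Data.List.Relation.Binary.Permutation.Setoid.Properties as Permutation
open import Data.List.Relation.Binary.Sublist.Propositional
  using (_⊆_; []; _∷_; minimum) renaming (_∷ʳ_ to _∷⁻_)
open import Data.List.Relation.Binary.Sublist.Propositional.Properties
  using (All-resp-⊆; length-mono-≤)
open import Data.List.Relation.Unary.All as All using (All; []; _∷_)
import Data.List.Relation.Unary.All.Properties as All
open import Data.List.Relation.Unary.AllPairs as AllPairs using (AllPairs; []; _∷_)
open import Data.List.Relation.Unary.Any using (here; there)
open import Data.List.Relation.Unary.Unique.Propositional using (Unique)
import Data.List.Relation.Unary.Unique.Propositional.Properties as Unique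
open import Data.Product using (∃; ∃₂; _×_; _,_; proj₁; proj₂; map₂)
open import Data.Sum using (_⊎_; inj₁; inj₂)
open import Data.Vec
  using (Vec; []; _∷_; _∷ʳ_; lookup; tabulate; toList; fromList; truncate; initLast; sum)
open import Data.Vec.Properties
  using (toList-injective; toList∘fromList; length-toList; toList-∷ʳ; tabulate-cong; cast-is-id)
open import Data.Vec.Relation.Unary.All as VecAll using ([]; _∷_)
import Data.Vec.Relation.Unary.All.Properties as VecAll
open import Data.Vec.Relation.Unary.AllPairs as VecAllPairs using ([]; _∷_)
open import Function using (_∘_; id; _⇔_; mk⇔; Equivalence)
open import Level using (Level)
open import Relation.Binary.PropositionalEquality
  using (refl; sym; trans; cong; cong₂; subst; setoid; module ≡-Reasoning)
open import Relation.Nullary using (¬_; contradiction)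
open import Relation.Nullary.Decidable using (_×-dec_)
open import Relation.Unary using (Pred)

private
  variable
    ℓ ℓ′ : Level
    A B : Set
    k m n : ℕ

-- Cardinalities of predicates

-- The elements of `xs` are pulled out of `ys` one at a time, and `zs` is what remains. Distinctness
-- guarantees that removing `x` leaves the rest of `xs` available in `as ++ bs`.
unique-⊆⇒↭ : {xs ys : List A} → Unique xs → (∀ {x} → x ∈ xs → x ∈ ys) →
             ∃ λ zs → ys ↭ xs ++ zs
unique-⊆⇒↭ {ys = ys} [] _ = ys , ↭-refl
unique-⊆⇒↭ (x∉xs ∷ xs!) xs⊆ys with ∈-∃++ (xs⊆ys (here refl))
... | as , bs , refl =
  map₂ (λ p → ↭-trans (shift _ as bs) (prep _ p)) (unique-⊆⇒↭ xs! xs⊆as++bs)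
  where
  xs⊆as++bs : ∀ {y} → y ∈ _ → y ∈ as ++ bs
  xs⊆as++bs y∈xs with ∈-++⁻ as (xs⊆ys (there y∈xs))
  ... | inj₁ y∈as         = ∈-++⁺ˡ y∈as
  ... | inj₂ (here refl)  = contradiction refl (All.lookup x∉xs y∈xs)
  ... | inj₂ (there y∈bs) = ∈-++⁺ʳ as y∈bs

-- A cardinality is witnessed by a duplicate-free enumeration, so that predicates can be counted by
-- combining enumerations, without deciding them.
record _HasSize_ {A : Set} (P : Pred A ℓ) (n : ℕ) : Set ℓ where
  field
    elements : List A
    unique   : Unique elements
    sound    : ∀ {x} → x ∈ elements → P x
    complete : ∀ {x} → P x → x ∈ elements
    size     : length elements ≡ n

open _HasSize_

size-mono : {P : Pred A ℓ} {Q : Pred A ℓ′} → (∀ {x} → P x → Q x) →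
            P HasSize m → Q HasSize n → m ≤ n
size-mono {m = m} {n} P⊆Q p q
  with zs , ↭ ← unique-⊆⇒↭ (unique p) (complete q ∘ P⊆Q ∘ sound p) = begin
  m                                 ≡⟨ size p ⟨
  length (elements p)               ≤⟨ m≤m+n _ _ ⟩
  length (elements p) + length zs   ≡⟨ length-++ (elements p) ⟨
  length (elements p ++ zs)         ≡⟨ ↭-length ↭ ⟨
  length (elements q)               ≡⟨ size q ⟩
  n                                 ∎
  where open ≤-Reasoning

-- Double counting: two enumerations of one predicate, however obtained, yield an equation between
-- numbers.
size-unique : {P : Pred A ℓ} → P HasSize m → P HasSize n → m ≡ n
size-unique p q = ≤-antisym (size-mono id p q) (size-mono id q p)

size-cong : {P : Pred A ℓ} {Q : Pred A ℓ′} → (∀ {x} → P x → Q x) →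
            (∀ {x} → Q x → P x) → P HasSize n → Q HasSize n
size-cong P⊆Q Q⊆P p = record
  { elements = elements p
  ; unique   = unique p
  ; sound    = P⊆Q ∘ sound p
  ; complete = complete p ∘ Q⊆P
  ; size     = size p
  }

size-subst : {P : Pred A ℓ} → m ≡ n → P HasSize m → P HasSize n
size-subst refl p = p

size-∅ : {P : Pred A ℓ} → (∀ {x} → ¬ P x) → P HasSize 0
size-∅ ¬P = record
  { elements = [] ; unique = [] ; sound = λ () ; complete = ⊥-elim ∘ ¬P ; size = refl }

size-⊎ : {P : Pred A ℓ} {Q : Pred A ℓ} → (∀ {x} → P x → ¬ Q x) →
         P HasSize m → Q HasSize n → (λ x → P x ⊎ Q x) HasSize (m + n)
size-⊎ {P = P} {Q} P#Q p q = record
  { elements = elements p ++ elements q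
  ; unique   = Unique.++⁺ (unique p) (unique q)
                 λ (x∈p , x∈q) → P#Q (sound p x∈p) (sound q x∈q)
  ; sound    = sound′
  ; complete = λ { (inj₁ Px) → ∈-++⁺ˡ (complete p Px)
                 ; (inj₂ Qx) → ∈-++⁺ʳ (elements p) (complete q Qx) }
  ; size     = trans (length-++ (elements p)) (cong₂ _+_ (size p) (size q))
  }
  where
  sound′ : ∀ {x} → x ∈ elements p ++ elements q → P x ⊎ Q x
  sound′ x∈ with ∈-++⁻ (elements p) x∈
  ... | inj₁ x∈p = inj₁ (sound p x∈p)
  ... | inj₂ x∈q = inj₂ (sound q x∈q)

size-map : {P : Pred A ℓ} (f : A → B) → (∀ {x y} → f x ≡ f y → x ≡ y) →
           P HasSize n → (λ y → ∃ λ x → P x × y ≡ f x) HasSize n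
size-map f f-inj p = record
  { elements = map f (elements p)
  ; unique   = Unique.map⁺ f-inj (unique p)
  ; sound    = λ y∈ → let x , x∈ , eq = ∈-map⁻ f y∈ in x , sound p x∈ , eq
  ; complete = λ { (x , Px , refl) → ∈-map⁺ f (complete p Px) }
  ; size     = trans (length-map f (elements p)) (size p)
  }

size-⋃-list : {Q : A → Pred B ℓ} {as : List A} → Unique as →
              (∀ {a} → a ∈ as → Q a HasSize n) →
              (∀ {a b y} → a ∈ as → b ∈ as → Q a y → Q b y → a ≡ b) →
              (λ y → ∃ λ a → a ∈ as × Q a y) HasSize (length as * n)
size-⋃-list [] _ _ = size-∅ λ { (_ , () , _) }
size-⋃-list (a∉as ∷ as!) q Q# =
  size-cong
    (λ { (inj₁ Qay) → _ , here refl , Qay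
       ; (inj₂ (b , b∈ , Qby)) → b , there b∈ , Qby })
    (λ { (_ , here refl , Qay) → inj₁ Qay
       ; (b , there b∈ , Qby) → inj₂ (b , b∈ , Qby) })
    (size-⊎
      (λ Qay (b , b∈ , Qby) → All.lookup a∉as b∈ (Q# (here refl) (there b∈) Qay Qby))
      (q (here refl))
      (size-⋃-list as! (q ∘ there) λ a∈ b∈ → Q# (there a∈) (there b∈)))

-- The product rule for a choice in two stages, where the second stage always offers `n`
-- possibilities. Disjointness takes the form that `y` determines the first choice.
size-⋃ : {P : Pred A ℓ} {Q : A → Pred B ℓ} → P HasSize m →
         (∀ {a} → P a → Q a HasSize n) →
         (∀ {a b y} → P a → P b → Q a y → Q b y → a ≡ b) →
         (λ y → ∃ λ a → P a × Q a y) HasSize (m * n)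
size-⋃ p q Q# =
  size-subst (cong (_* _) (size p))
    (size-cong
      (λ (a , a∈ , Qay) → a , sound p a∈ , Qay)
      (λ (a , Pa , Qay) → a , complete p Pa , Qay)
      (size-⋃-list (unique p) (q ∘ sound p) λ a∈ b∈ → Q# (sound p a∈) (sound p b∈)))

size-⋃-Fin : {Q : Fin n → Pred A ℓ} (q : Fin n → ℕ) → (∀ i → Q i HasSize q i) →
             (∀ {i j x} → Q i x → Q j x → i ≡ j) →
             (λ x → ∃ λ i → Q i x) HasSize sum (tabulate q)
size-⋃-Fin {n = zero}  q Qq Q# = size-∅ λ ()
size-⋃-Fin {n = suc n} q Qq Q# =
  size-cong
    (λ { (inj₁ Q₀) → zero , Q₀ ; (inj₂ (i , Qᵢ)) → suc i , Qᵢ })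
    (λ { (zero , Q₀) → inj₁ Q₀ ; (suc i , Qᵢ) → inj₂ (i , Qᵢ) })
    (size-⊎ (λ Q₀ (i , Qᵢ) → Fin.0≢1+n (Q# Q₀ Qᵢ))
      (Qq zero)
      (size-⋃-Fin (q ∘ suc) (Qq ∘ suc) λ Qᵢ Qⱼ → Fin.suc-injective (Q# Qᵢ Qⱼ)))

-- Sublists and descending lists

Unique-resp-↭ : {xs ys : List A} → xs ↭ ys → Unique xs → Unique ys
Unique-resp-↭ = Permutation.Unique-resp-↭ (setoid _) ∘ ↭⇒↭ₛ

AllPairs-resp-⊆ : {R : A → A → Set} {xs ys : List A} → xs ⊆ ys → AllPairs R ys → AllPairs R xs
AllPairs-resp-⊆ []           []       = []
AllPairs-resp-⊆ (y ∷⁻ p)     (_ ∷ ps) = AllPairs-resp-⊆ p ps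
AllPairs-resp-⊆ (refl ∷ p) (q ∷ ps) = All-resp-⊆ p q ∷ AllPairs-resp-⊆ p ps

++-cancelˡ-↭ : (xs : List A) {ys zs : List A} → xs ++ ys ↭ xs ++ zs → ys ↭ zs
++-cancelˡ-↭ []       p = p
++-cancelˡ-↭ (x ∷ xs) p = ++-cancelˡ-↭ xs (drop-∷ p)

-- The complement is built as a sublist, not just up to rearrangement, so that it inherits the
-- descending order of `ys`.
complement : {xs ys : List A} → xs ⊆ ys → ∃ λ zs → zs ⊆ ys × xs ++ zs ↭ ys
complement []       = [] , [] , ↭-refl
complement {xs = xs} (y ∷⁻ p) =
  let zs , q , ↭ = complement p in
  y ∷ zs , refl ∷ q , ↭-trans (shift y xs zs) (prep y ↭)
complement (refl ∷ p) = let zs , q , ↭ = complement p in zs , _ ∷⁻ q , prep _ ↭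

-- Pascal's rule: a sublist of `x ∷ xs` either keeps or drops `x`. Since `x` does not recur in `xs`,
-- no list arises in both ways.
size-sublists : {xs : List A} → Unique xs → ∀ i →
                (λ ys → ys ⊆ xs × length ys ≡ i) HasSize (length xs C i)
size-sublists {xs = xs} xs! zero = record
  { elements = [ [] ]
  ; unique   = [] ∷ []
  ; sound    = λ { (here refl) → minimum xs , refl }
  ; complete = λ { {[]} _ → here refl }
  ; size     = refl
  }
size-sublists [] (suc i) = size-∅ λ { ([] , ()) }
size-sublists {xs = x ∷ xs} (x∉xs ∷ xs!) (suc i) =
  size-subst (nCk+nC[k+1]≡[n+1]C[k+1] (length xs) i)
    (size-cong
      (λ { (inj₁ (_ , (p , eq) , refl)) → refl ∷ p , cong suc eq
         ; (inj₂ (p , eq)) → x ∷⁻ p , eq })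
      (λ { (refl ∷ p , eq) → inj₁ (_ , (p , suc-injective eq) , refl)
         ; (_ ∷⁻ p , eq) → inj₂ (p , eq) })
      (size-⊎
        (λ { (_ , _ , refl) (p , _) → All.lookup (All-resp-⊆ p x∉xs) (here refl) refl })
        (size-map (x ∷_) ∷-injectiveʳ (size-sublists xs! i))
        (size-sublists xs! (suc i))))

-- Finite sets of letters are represented by strictly descending lists, which makes subsets the same
-- as sublists.
Descending : List ℕ → Set
Descending = AllPairs _>_

descending⇒unique : ∀ {xs} → Descending xs → Unique xs
descending⇒unique = AllPairs.map >⇒≢

-- Both lists follow the same order. Unless `x` is `y`, it lies in `ys` and so below `y`; all of
-- `x ∷ xs` is then below `y`, and `y` can be skipped.
descending-⊆ : ∀ {xs ys} → Descending xs → Descending ys →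
               (∀ {x} → x ∈ xs → x ∈ ys) → xs ⊆ ys
descending-⊆ [] ys↓ xs⊆ys = minimum _
descending-⊆ {ys = []} (x> ∷ xs↓) ys↓ xs⊆ys = contradiction (xs⊆ys (here refl)) λ ()
descending-⊆ {x ∷ xs} {y ∷ ys} (x> ∷ xs↓) (y> ∷ ys↓) xs⊆ys with xs⊆ys (here refl)
... | here refl = refl ∷ descending-⊆ xs↓ ys↓ tail
  where
  tail : ∀ {z} → z ∈ xs → z ∈ ys
  tail z∈ with xs⊆ys (there z∈)
  ... | here refl  = contradiction (All.lookup x> z∈) (<-irrefl refl)
  ... | there z∈ys = z∈ys
... | there x∈ys = y ∷⁻ descending-⊆ (x> ∷ xs↓) ys↓ skip
  where
  x≥ : ∀ {z} → z ∈ x ∷ xs → z ≤ x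
  x≥ (here refl) = ≤-refl
  x≥ (there z∈)  = <⇒≤ (All.lookup x> z∈)

  skip : ∀ {z} → z ∈ x ∷ xs → z ∈ ys
  skip z∈ with xs⊆ys z∈
  ... | here refl  = contradiction (x≥ z∈) (<⇒≱ (All.lookup y> x∈ys))
  ... | there z∈ys = z∈ys

-- Words avoiding 12-3

-- Avoidance of 12-3 by recursion on adjacent pairs instead of by indices, which suits cutting a
-- word as `L ++ x ∷ r`.
data Avoiding : List ℕ → Set where
  []  : Avoiding []
  [-] : ∀ {a} → Avoiding [ a ]
  _∷_ : ∀ {a b w} → (a < b → All (_≤ b) w) → Avoiding (b ∷ w) → Avoiding (a ∷ b ∷ w)

avoiding-++⁻ʳ : ∀ u {v} → Avoiding (u ++ v) → Avoiding v
avoiding-++⁻ʳ []           av       = av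
avoiding-++⁻ʳ (a ∷ [])     {[]}     [-] = []
avoiding-++⁻ʳ (a ∷ [])     {b ∷ v}  (_ ∷ av) = av
avoiding-++⁻ʳ (a ∷ b ∷ u)  (_ ∷ av) = avoiding-++⁻ʳ (b ∷ u) av

-- An ascent to `b` inside `L` would bound every later letter by `b`, yet `x` comes later and
-- exceeds `b`. Distinctness makes the descent strict.
avoiding⇒descending : ∀ {x r} L → All (_< x) L → Unique (L ++ x ∷ r) →
                      Avoiding (L ++ x ∷ r) → Descending L
avoiding⇒descending []           _ _ _ = []
avoiding⇒descending (a ∷ [])     _ _ _ = [] ∷ []
avoiding⇒descending (a ∷ b ∷ L) (_ ∷ L<x@(b<x ∷ _)) ((a≢b ∷ _) ∷ !) (a<b⇒ ∷ av)
  with avoiding⇒descending (b ∷ L) L<x ! av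
... | b> ∷ L↓ = (a>b ∷ All.map (λ c<b → <-trans c<b a>b) b>) ∷ b> ∷ L↓
  where
  a>b : a > b
  a>b = ≤∧≢⇒<
    (≮⇒≥ λ a<b → <⇒≱ b<x (All.lookup (a<b⇒ a<b) (∈-++⁺ʳ L (here refl))))
    (a≢b ∘ sym)

-- The only possible ascent outside `r` is the one ending in `x`, and no letter of `r` exceeds `x`.
avoiding-++⁺ : ∀ {x r} L → Descending L → All (_≤ x) r → Avoiding r → Avoiding (L ++ x ∷ r)
avoiding-++⁺ [] _ _ [] = [-]
avoiding-++⁺ [] _ (b≤x ∷ _) av@[-]     = (λ x<b → contradiction b≤x (<⇒≱ x<b)) ∷ av
avoiding-++⁺ [] _ (b≤x ∷ _) av@(_ ∷ _) = (λ x<b → contradiction b≤x (<⇒≱ x<b)) ∷ av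
avoiding-++⁺ (a ∷ []) _ r≤x av = (λ _ → r≤x) ∷ avoiding-++⁺ [] [] r≤x av
avoiding-++⁺ (a ∷ b ∷ L) ((a>b ∷ _) ∷ L↓) r≤x av =
  (λ a<b → contradiction a<b (<-asym a>b)) ∷ avoiding-++⁺ (b ∷ L) L↓ r≤x av

Avoiders : List ℕ → Pred (List ℕ) _
Avoiders S w = w ↭ S × Avoiding w

-- The avoiders of x ∷ S with x in position i, counted from 0, when x exceeds
-- the letters of the descending list S.
AvoidersWithMaxAt : ℕ → List ℕ → ℕ → Pred (List ℕ) _
AvoidersWithMaxAt x S i w =
  ∃ λ L → (L ⊆ S × length L ≡ i) ×
  ∃ λ r → (L ++ r ↭ S × Avoiding r) × w ≡ L ++ x ∷ r

-- Both words are cut at their first `x`. Thus a word determines the set of letters before its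
-- maximum, which gives the disjointness needed for counting.
++-∷-injectiveˡ : {x : A} (L L′ : List A) {r r′ : List A} → x ∉ L → x ∉ L′ →
                  L ++ x ∷ r ≡ L′ ++ x ∷ r′ → L ≡ L′
++-∷-injectiveˡ []      []       _   _    _  = refl
++-∷-injectiveˡ []      (_ ∷ _)  _   x∉L′ eq = contradiction (here (∷-injectiveˡ eq)) x∉L′
++-∷-injectiveˡ (_ ∷ _) []       x∉L _    eq = contradiction (here (sym (∷-injectiveˡ eq))) x∉L
++-∷-injectiveˡ (_ ∷ L) (_ ∷ L′) x∉L x∉L′ eq =
  cong₂ _∷_ (∷-injectiveˡ eq) (++-∷-injectiveˡ L L′ (x∉L ∘ there) (x∉L′ ∘ there) (∷-injectiveʳ eq))

module _ {x : ℕ} {S : List ℕ} (S<x : All (_< x) S) (S↓ : Descending S) where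

  ⊆⇒∌ : ∀ {L} → L ⊆ S → x ∉ L
  ⊆⇒∌ L⊆S x∈L = <-irrefl refl (All.lookup (All-resp-⊆ L⊆S S<x) x∈L)

  -- First `L` is chosen among the sublists of length `i`, then `r` among the avoiders on the
  -- complement. The complement varies with `L`, so the hypothesis covers all sublists of `S`.
  size-avoidersWithMaxAt :
    (∀ {R} → R ⊆ S → Avoiders R HasSize bell (length R)) →
    ∀ i → AvoidersWithMaxAt x S i HasSize ((length S C i) * bell (length S ∸ i))
  size-avoidersWithMaxAt ih i =
    size-⋃ (size-sublists (descending⇒unique S↓) i) size-right
      λ { {L} {L′} (L⊆S , _) (L′⊆S , _) (_ , _ , refl) (_ , _ , eq) →
          ++-∷-injectiveˡ L L′ (⊆⇒∌ L⊆S) (⊆⇒∌ L′⊆S) eq }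
    where
    size-right : ∀ {L} → L ⊆ S × length L ≡ i →
                 (λ w → ∃ λ r → (L ++ r ↭ S × Avoiding r) × w ≡ L ++ x ∷ r)
                 HasSize bell (length S ∸ i)
    -- Let `R` be the complement of `L`. Cancelling `L` turns `L ++ r ↭ S` into `r ↭ R`, so the
    -- hypothesis for `R` counts the words `r`.
    size-right {L} (L⊆S , refl) with R , R⊆S , L++R↭S ← complement L⊆S =
      size-subst (cong bell |R|)
        (size-cong
          (λ (r , (r↭R , av) , eq) → r , (↭-trans (++⁺ˡ L r↭R) L++R↭S , av) , eq)
          (λ (r , (L++r↭S , av) , eq) →
            r , (++-cancelˡ-↭ L (↭-trans L++r↭S (↭-sym L++R↭S)) , av) , eq)
          (size-map (λ r → L ++ x ∷ r) (∷-injectiveʳ ∘ ++-cancelˡ L _ _) (ih R⊆S)))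
      where
      |R| : length R ≡ length S ∸ length L
      |R| = begin
        length R                        ≡⟨ m+n∸m≡n (length L) _ ⟨
        length L + length R ∸ length L  ≡⟨ cong (_∸ length L) (length-++ L) ⟨
        length (L ++ R) ∸ length L      ≡⟨ cong (_∸ length L) (↭-length L++R↭S) ⟩
        length S ∸ length L             ∎
        where open ≡-Reasoning

  -- The descent of `L` is assumed because it has two sources: avoidance in a word with maximum `x`,
  -- or a prescribed prefix.
  avoiders⇒withMaxAt : ∀ {L r} → Descending L → L ++ x ∷ r ↭ x ∷ S → Avoiding (L ++ x ∷ r) →
                       AvoidersWithMaxAt x S (length L) (L ++ x ∷ r)
  avoiders⇒withMaxAt {L} {r} L↓ p av =
    L , (descending-⊆ L↓ S↓ (∈-resp-↭ L++r↭S ∘ ∈-++⁺ˡ) , refl) , r ,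
    (L++r↭S , avoiding-++⁻ʳ [ x ] (avoiding-++⁻ʳ L av)) , refl
    where
    L++r↭S : L ++ r ↭ S
    L++r↭S = drop-mid L [] p

  withMaxAt⇒avoiders : ∀ {i w} → AvoidersWithMaxAt x S i w → Avoiders (x ∷ S) w
  withMaxAt⇒avoiders (L , (L⊆S , _) , r , (L++r↭S , av) , refl) =
    ↭-trans (shift x L r) (prep x L++r↭S) ,
    avoiding-++⁺ L (AllPairs-resp-⊆ L⊆S S↓)
      (All.map <⇒≤ (All.++⁻ʳ L (All-resp-↭ (↭-sym L++r↭S) S<x))) av

  avoiders⇒∃withMaxAt : ∀ {w} → Avoiders (x ∷ S) w →
                        ∃ λ (i : Fin (suc (length S))) → AvoidersWithMaxAt x S (toℕ i) w
  avoiders⇒∃withMaxAt (p , av) with ∈-∃++ (∈-resp-↭ (↭-sym p) (here refl))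
  ... | L , r , refl =
    fromℕ< |L|< , subst (λ i → AvoidersWithMaxAt x S i _) (sym (Fin.toℕ-fromℕ< |L|<)) at
    where
    L<x : All (_< x) L
    L<x = All.++⁻ˡ L (All-resp-↭ (↭-sym (drop-mid L [] p)) S<x)

    at : AvoidersWithMaxAt x S (length L) (L ++ x ∷ r)
    at = avoiders⇒withMaxAt
      (avoiding⇒descending L L<x
        (Unique-resp-↭ (↭-sym p) (All.map >⇒≢ S<x ∷ descending⇒unique S↓)) av) p av

    |L|< : length L < suc (length S)
    |L|< = s≤s (length-mono-≤ (proj₁ (proj₁ (proj₂ at))))

  withMaxAt-injective : ∀ {i j w} → AvoidersWithMaxAt x S i w → AvoidersWithMaxAt x S j w → i ≡ j
  withMaxAt-injective (L , (L⊆S , refl) , _ , _ , refl) (L′ , (L′⊆S , refl) , _ , _ , eq) =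
    cong length (++-∷-injectiveˡ L L′ (⊆⇒∌ L⊆S) (⊆⇒∌ L′⊆S) eq)

-- Avoiders and the Bell recurrence

lookup-bells : ∀ m (i : Fin (suc m)) → lookup (bells m) i ≡ bell (m ∸ toℕ i)
lookup-bells zero    zero    = refl
lookup-bells (suc m) zero    = refl
lookup-bells (suc m) (suc i) = lookup-bells m i

bell-suc : ∀ m → sum (tabulate {n = suc m} λ i → (m C toℕ i) * bell (m ∸ toℕ i)) ≡ bell (suc m)
bell-suc m = cong sum (tabulate-cong λ i → cong ((m C toℕ i) *_) (sym (lookup-bells m i)))

size-avoiders : ∀ {S} → Descending S → Avoiders S HasSize bell (length S)
size-avoiders S↓ = go _ ≤-refl S↓
  where
  -- The recursion descends on a bound for the length, since it must reach arbitrary sublists of the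
  -- tail, which are not subterms.
  go : ∀ n {S} → length S ≤ n → Descending S → Avoiders S HasSize bell (length S)
  go n {[]} _ _ = record
    { elements = [ [] ]
    ; unique   = [] ∷ []
    ; sound    = λ { (here refl) → ↭-refl , [] }
    ; complete = λ (p , _) → here (↭-empty-inv p)
    ; size     = refl
    }
  go (suc n) {x ∷ S} (s≤s |S|≤n) (S<x ∷ S↓) =
    size-subst (bell-suc (length S))
      (size-cong (withMaxAt⇒avoiders S<x S↓ ∘ proj₂) (avoiders⇒∃withMaxAt S<x S↓)
        (size-⋃-Fin (λ i → (length S C toℕ i) * bell (length S ∸ toℕ i))
          (size-avoidersWithMaxAt S<x S↓ ih ∘ toℕ)
          λ Qᵢ Qⱼ → Fin.toℕ-injective (withMaxAt-injective S<x S↓ Qᵢ Qⱼ)))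
    where
    ih : ∀ {R} → R ⊆ S → Avoiders R HasSize bell (length R)
    ih R⊆S = go n (≤-trans (length-mono-≤ R⊆S) |S|≤n) (AllPairs-resp-⊆ R⊆S S↓)

-- From words to lists

allPairs-toList⁺ : {R : A → A → Set} {xs : Vec A n} →
                   VecAllPairs.AllPairs R xs → AllPairs R (toList xs)
allPairs-toList⁺ []       = []
allPairs-toList⁺ (p ∷ ps) = VecAll.toList⁺ p ∷ allPairs-toList⁺ ps

allPairs-toList⁻ : {R : A → A → Set} {xs : Vec A n} →
                   AllPairs R (toList xs) → VecAllPairs.AllPairs R xs
allPairs-toList⁻ {xs = []}    []       = []
allPairs-toList⁻ {xs = _ ∷ _} (p ∷ ps) = VecAll.toList⁻ p ∷ allPairs-toList⁻ ps

both : {P Q : Set} → P → Q → P ⇔ Q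
both p q = mk⇔ (λ _ → q) (λ _ → p)

neither : {P Q : Set} → ¬ P → ¬ Q → P ⇔ Q
neither ¬p ¬q = mk⇔ (⊥-elim ∘ ¬p) (⊥-elim ∘ ¬q)

orderIsomorphic-123 : ∀ {a b c} → a < b → b < c →
                      OrderIsomorphic (a ∷ b ∷ c ∷ []) (1 ∷ 2 ∷ 3 ∷ [])
orderIsomorphic-123 {a} {b} {c} a<b b<c = iso
  where
  a<c = <-trans a<b b<c
  1<2 = n<1+n 1
  2<3 = n<1+n 2
  1<3 = <-trans 1<2 2<3

  iso : OrderIsomorphic (a ∷ b ∷ c ∷ []) (1 ∷ 2 ∷ 3 ∷ [])
  iso zero             zero             = neither (<-irrefl refl) (<-irrefl refl)
  iso zero             (suc zero)       = both a<b 1<2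
  iso zero             (suc (suc zero)) = both a<c 1<3
  iso (suc zero)       zero             = neither (<-asym a<b) (<-asym 1<2)
  iso (suc zero)       (suc zero)       = neither (<-irrefl refl) (<-irrefl refl)
  iso (suc zero)       (suc (suc zero)) = both b<c 2<3
  iso (suc (suc zero)) zero             = neither (<-asym a<c) (<-asym 1<3)
  iso (suc (suc zero)) (suc zero)       = neither (<-asym b<c) (<-asym 2<3)
  iso (suc (suc zero)) (suc (suc zero)) = neither (<-irrefl refl) (<-irrefl refl)

avoids⇒avoiding : (π : Vec ℕ n) → Avoids12-3 π → Avoiding (toList π)
avoids⇒avoiding []          _  = []
avoids⇒avoiding (a ∷ [])    _  = [-]
avoids⇒avoiding (a ∷ b ∷ π) av =
  (λ a<b → VecAll.toList⁺ (VecAll.lookup⁻ λ j → ≮⇒≥ λ b<c →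
    av (zero , suc zero , suc (suc j) , refl , s≤s z<s , orderIsomorphic-123 a<b b<c)))
  ∷ avoids⇒avoiding (b ∷ π) λ (i , i′ , j , eq , i′<j , o) →
      av (suc i , suc i′ , suc j , cong suc eq , s≤s i′<j , o)

avoiding⇒avoids : (π : Vec ℕ n) → Avoiding (toList π) → Avoids12-3 π
avoiding⇒avoids (a ∷ [])    _        (zero , zero , _ , () , _)
avoiding⇒avoids (a ∷ b ∷ π) _        (zero , suc zero , suc zero , _ , s≤s () , _)
-- An occurrence starting at the first letter: comparing the pattern letters 1 < 2 and 2 < 3 gives
-- an ascent from `a` to `b` and a later letter above `b`.
avoiding⇒avoids (a ∷ b ∷ π) (h ∷ _)  (zero , suc zero , suc (suc j) , _ , _ , o) =
  <⇒≱ (Equivalence.from (o (suc zero) (suc (suc zero))) (n<1+n 2))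
    (VecAll.lookup⁺ (VecAll.toList⁻ (h (Equivalence.from (o zero (suc zero)) (n<1+n 1)))) j)
avoiding⇒avoids (a ∷ b ∷ π) _        (zero , suc (suc _) , _ , () , _)
avoiding⇒avoids (a ∷ b ∷ π) (_ ∷ av) (suc i , suc i′ , suc j , eq , s≤s i′<j , o) =
  avoiding⇒avoids (b ∷ π) av (i , i′ , j , suc-injective eq , i′<j , o)

-- Permutations as rearrangements of the descending list

∈-words⁺ : ∀ {ls} {w : Vec ℕ n} → VecAll.All (_∈ ls) w → w ∈ words ls n
∈-words⁺ []       = here refl
∈-words⁺ (p ∷ ps) = ∈-cartesianProductWith⁺ _∷_ p (∈-words⁺ ps)

∈-words⁻ : ∀ {ls} {w : Vec ℕ n} → w ∈ words ls n → VecAll.All (_∈ ls) w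
∈-words⁻ {n = zero}  {w = []} _ = []
∈-words⁻ {n = suc n} {ls} w∈
  with _ , _ , a∈ , v∈ , refl ← ∈-cartesianProductWith⁻ _∷_ ls (words ls n) w∈ = a∈ ∷ ∈-words⁻ v∈

words-unique : ∀ {ls} → Unique ls → ∀ n → Unique (words ls n)
words-unique ls! zero    = [] ∷ []
words-unique ls! (suc n) =
  Unique.cartesianProductWith⁺ _∷_ (λ { refl → refl , refl }) ls! (words-unique ls! n)

permutations-unique : ∀ n → Unique (permutations n)
permutations-unique n =
  Unique.filter⁺ unique? (words-unique (Unique.map⁺ suc-injective (Unique.upTo⁺ n)) n)

∈-descending⁺ : ∀ {i} → i < m → suc i ∈ toList (descending m)
∈-descending⁺ {suc m} (s≤s i≤m) with m≤n⇒m<n∨m≡n i≤m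
... | inj₁ i<m  = there (∈-descending⁺ i<m)
... | inj₂ refl = here refl

∈-descending⁻ : ∀ {j} → j ∈ toList (descending m) → ∃ λ i → i < m × j ≡ suc i
∈-descending⁻ {suc m} (here refl) = m , ≤-refl , refl
∈-descending⁻ {suc m} (there j∈)  = map₂ (λ (i<m , eq) → m<n⇒m<1+n i<m , eq) (∈-descending⁻ j∈)

descending-< : ∀ m → VecAll.All (_< suc m) (descending m)
descending-< zero    = []
descending-< (suc m) = ≤-refl ∷ VecAll.map m<n⇒m<1+n (descending-< m)

descending-descending : ∀ m → VecAllPairs.AllPairs _>_ (descending m)
descending-descending zero    = []
descending-descending (suc m) = descending-< m ∷ descending-descending m

-- The `n` distinct letters of `π` all occur in `descending n`; a letter left over would push the
-- length of that list above `n`.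
∈-permutations⁻ : (π : Vec ℕ n) → π ∈ permutations n → toList π ↭ toList (descending n)
∈-permutations⁻ {n} π π∈ =
  let π∈words , π! = ∈-filter⁻ unique? π∈
      zs , ↭ = unique-⊆⇒↭ (allPairs-toList⁺ π!)
                 (letter ∘ All.lookup (VecAll.toList⁺ (∈-words⁻ π∈words)))
  in noRest zs ↭
  where
  letter : ∀ {j} → j ∈ map suc (upTo n) → j ∈ toList (descending n)
  letter j∈ with _ , i∈ , refl ← ∈-map⁻ suc j∈ = ∈-descending⁺ (∈-upTo⁻ i∈)

  noRest : ∀ zs → toList (descending n) ↭ toList π ++ zs → toList π ↭ toList (descending n)
  noRest []       p = ↭-sym (↭-trans p (++-identityʳ _))
  noRest (z ∷ zs) p = contradiction n≡ (m≢1+m+n n)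
    where
    n≡ : n ≡ suc (n + length zs)
    n≡ = begin
      n                                 ≡⟨ length-toList (descending n) ⟨
      length (toList (descending n))    ≡⟨ ↭-length p ⟩
      length (toList π ++ z ∷ zs)       ≡⟨ length-++ (toList π) ⟩
      length (toList π) + suc (length zs)  ≡⟨ cong (_+ _) (length-toList π) ⟩
      n + suc (length zs)               ≡⟨ +-suc n _ ⟩
      suc (n + length zs)               ∎
      where open ≡-Reasoning

∈-permutations⁺ : (π : Vec ℕ n) → toList π ↭ toList (descending n) → π ∈ permutations n
∈-permutations⁺ {n} π p =
  ∈-filter⁺ unique? (∈-words⁺ (VecAll.toList⁻ (All.tabulate (letter ∘ ∈-resp-↭ p))))
    (allPairs-toList⁻ (Unique-resp-↭ (↭-sym p)
      (descending⇒unique (allPairs-toList⁺ (descending-descending n)))))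
  where
  letter : ∀ {j} → j ∈ toList (descending n) → j ∈ map suc (upTo n)
  letter j∈ with _ , i<n , refl ← ∈-descending⁻ j∈ = ∈-map⁺ suc (∈-upTo⁺ i<n)

-- Prefixes order-isomorphic to (k-1)⋯1k

SameSide : ℕ → ℕ → ℕ → ℕ → Set
SameSide x a y b = (x < a ⇔ y < b) × (a < x ⇔ b < y)

sameSide-∷ʳ⁺ : ∀ {x y b t} {l d : Vec ℕ n} →
               VecAll.All (_< x) l → x < b → VecAll.All (_< y) d → y < t →
               ∀ j → SameSide x (lookup (l ∷ʳ b) j) y (lookup (d ∷ʳ t) j)
sameSide-∷ʳ⁺ []        x<b []        y<t zero    = both x<b y<t , neither (<-asym x<b) (<-asym y<t)
sameSide-∷ʳ⁺ (a<x ∷ _) x<b (c<y ∷ _) y<t zero    = neither (<-asym a<x) (<-asym c<y) , both a<x c<y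
sameSide-∷ʳ⁺ (_ ∷ l<x) x<b (_ ∷ d<y) y<t (suc j) = sameSide-∷ʳ⁺ l<x x<b d<y y<t j

sameSide-∷ʳ⁻ : ∀ {x y b t} {l d : Vec ℕ n} → VecAll.All (_< y) d → y < t →
               (∀ j → SameSide x (lookup (l ∷ʳ b) j) y (lookup (d ∷ʳ t) j)) →
               VecAll.All (_< x) l × x < b
sameSide-∷ʳ⁻ {l = []}    []          y<t s = [] , Equivalence.from (proj₁ (s zero)) y<t
sameSide-∷ʳ⁻ {l = _ ∷ _} (c<y ∷ d<y) y<t s =
  let l<x , x<b = sameSide-∷ʳ⁻ d<y y<t (s ∘ suc)
  in Equivalence.from (proj₂ (s zero)) c<y ∷ l<x , x<b

DescendingBelow : ℕ → Vec ℕ n → Set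
DescendingBelow b l = VecAllPairs.AllPairs _>_ l × VecAll.All (_< b) l

-- The pattern is a general `d ∷ʳ t` for the sake of induction: without its first letter,
-- (k-1)(k-2)⋯1k becomes (k-2)⋯1k, which is no `descendingThenMax`. `SameSide` handles the
-- comparisons with the first letter in both directions.
orderIsomorphic-∷ʳ⁺ : ∀ {b t} {l d : Vec ℕ n} → DescendingBelow b l → DescendingBelow t d →
                      OrderIsomorphic (l ∷ʳ b) (d ∷ʳ t)
orderIsomorphic-∷ʳ⁺ {l = []}    {[]}    _ _ zero zero = neither (<-irrefl refl) (<-irrefl refl)
orderIsomorphic-∷ʳ⁺ {l = _ ∷ _} {_ ∷ _} _ _ zero zero = neither (<-irrefl refl) (<-irrefl refl)
orderIsomorphic-∷ʳ⁺ (x> ∷ _ , x<b ∷ _) (y> ∷ _ , y<t ∷ _) zero (suc j) =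
  proj₁ (sameSide-∷ʳ⁺ x> x<b y> y<t j)
orderIsomorphic-∷ʳ⁺ (x> ∷ _ , x<b ∷ _) (y> ∷ _ , y<t ∷ _) (suc i) zero =
  proj₂ (sameSide-∷ʳ⁺ x> x<b y> y<t i)
orderIsomorphic-∷ʳ⁺ (_ ∷ l↓ , _ ∷ l<b) (_ ∷ d↓ , _ ∷ d<t) (suc i) (suc j) =
  orderIsomorphic-∷ʳ⁺ (l↓ , l<b) (d↓ , d<t) i j

orderIsomorphic-∷ʳ⁻ : ∀ {b t} {l d : Vec ℕ n} → DescendingBelow t d →
                      OrderIsomorphic (l ∷ʳ b) (d ∷ʳ t) → DescendingBelow b l
orderIsomorphic-∷ʳ⁻ {l = []} _ _ = [] , []
orderIsomorphic-∷ʳ⁻ {l = _ ∷ _} {_ ∷ _} (y> ∷ d↓ , y<t ∷ d<t) o =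
  let l↓ , l<b = orderIsomorphic-∷ʳ⁻ (d↓ , d<t) λ i j → o (suc i) (suc j)
      x> , x<b = sameSide-∷ʳ⁻ y> y<t λ j → o zero (suc j) , o (suc j) zero
  in x> ∷ l↓ , x<b ∷ l<b

descending-descendingBelow : ∀ m → DescendingBelow (suc m) (descending m)
descending-descendingBelow m = descending-descending m , descending-< m

-- The convention for the empty permutation concerns only a pattern of length 1.
beginsWith⁻ : {p : Vec ℕ k} {π : Vec ℕ n} → 2 ≤ k → BeginsWith p π →
              ∃ λ k≤n → OrderIsomorphic (truncate k≤n π) p
beginsWith⁻ _        (prefix k≤n o) = k≤n , o
beginsWith⁻ (s≤s ()) empty

toList-truncate : (k≤n : k ≤ n) (π : Vec ℕ n) → ∃ λ r → toList π ≡ toList (truncate k≤n π) ++ r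
toList-truncate z≤n       π       = toList π , refl
toList-truncate (s≤s k≤n) (a ∷ π) = map₂ (cong (a ∷_)) (toList-truncate k≤n π)

truncate-prefix : (k≤n : k ≤ n) (π : Vec ℕ n) (p : Vec ℕ k) {r : List ℕ} →
                  toList π ≡ toList p ++ r → truncate k≤n π ≡ p
truncate-prefix z≤n       π       []      _  = refl
truncate-prefix (s≤s k≤n) (a ∷ π) (b ∷ p) eq =
  cong₂ _∷_ (∷-injectiveˡ eq) (truncate-prefix k≤n π p (∷-injectiveʳ eq))

toList-∷ʳ-++ : (l : Vec ℕ n) (b : ℕ) (r : List ℕ) → toList (l ∷ʳ b) ++ r ≡ toList l ++ b ∷ r
toList-∷ʳ-++ l b r = trans (cong (_++ r) (toList-∷ʳ b l)) (++-assoc (toList l) [ b ] r)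

beginsWith-descendingThenMax⁻ :
  ∀ {i} {π : Vec ℕ n} → 1 ≤ i → BeginsWith (descendingThenMax (suc i)) π →
  ∃₂ λ (l : Vec ℕ i) b → DescendingBelow b l × ∃ λ r → toList π ≡ toList l ++ b ∷ r
beginsWith-descendingThenMax⁻ {i = i} {π} 1≤i begins
  with k≤n , o ← beginsWith⁻ (s≤s 1≤i) begins = split (truncate k≤n π) o (toList-truncate k≤n π)
  where
  -- The truncation is generalized to a variable `u`, so that its last letter can be split off by
  -- matching on `initLast u`.
  split : (u : Vec ℕ (suc i)) → OrderIsomorphic u (descending i ∷ʳ suc i) →
          (∃ λ r → toList π ≡ toList u ++ r) →
          ∃₂ λ (l : Vec ℕ i) b → DescendingBelow b l × ∃ λ r → toList π ≡ toList l ++ b ∷ r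
  split u o (r , eq) with l , b , refl ← initLast u =
    l , b , orderIsomorphic-∷ʳ⁻ (descending-descendingBelow i) o ,
    r , trans eq (toList-∷ʳ-++ l b r)

beginsWith-descendingThenMax⁺ :
  ∀ {i b r} {π : Vec ℕ n} (l : Vec ℕ i) → suc i ≤ n → DescendingBelow b l →
  toList π ≡ toList l ++ b ∷ r → BeginsWith (descendingThenMax (suc i)) π
beginsWith-descendingThenMax⁺ {i = i} {b} {r} {π} l i<n l↓ eq =
  prefix i<n
    (subst (λ u → OrderIsomorphic u (descendingThenMax (suc i)))
      (sym (truncate-prefix i<n π (l ∷ʳ b) (trans eq (sym (toList-∷ʳ-++ l b r)))))
      (orderIsomorphic-∷ʳ⁺ l↓ (descending-descendingBelow i)))

-- As `L` is nonempty, its last letter and `b` form an ascent, beyond which nothing may exceed `b`.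
avoiding-afterAscent : ∀ {b r} L → 1 ≤ length L → All (_< b) L → Avoiding (L ++ b ∷ r) →
                       All (_≤ b) r
avoiding-afterAscent (a ∷ [])     _ (a<b ∷ _) (h ∷ _)  = h a<b
avoiding-afterAscent (a ∷ c ∷ L)  _ (_ ∷ L<b) (_ ∷ av) = avoiding-afterAscent (c ∷ L) z<s L<b av

vecOfLength : (w : List ℕ) → length w ≡ n → ∃ λ (v : Vec ℕ n) → w ≡ toList v
vecOfLength w refl = fromList w , sym (toList∘fromList w)

-- Counting the avoiders with the prescribed prefix

module _ (m : ℕ) where

  private
    S = toList (descending m)

    S<1+m : All (_< suc m) S
    S<1+m = VecAll.toList⁺ (descending-< m)

    S↓ : Descending S
    S↓ = allPairs-toList⁺ (descending-descending m)

  counted⇒withMaxAt : ∀ {i} (π : Vec ℕ (suc m)) → 1 ≤ i → π ∈ permutations (suc m) →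
                      Avoids12-3 π → BeginsWith (descendingThenMax (suc i)) π →
                      AvoidersWithMaxAt (suc m) S i (toList π)
  counted⇒withMaxAt {i} π 1≤i π∈ av begins
    with l , b , (l↓ , l<b) , r , eq ← beginsWith-descendingThenMax⁻ 1≤i begins =
    subst (AvoidersWithMaxAt (suc m) S i) (sym eq)
      (atMax b≡1+m p)
    where
    L = toList l

    avL : Avoiding (L ++ b ∷ r)
    avL = subst Avoiding eq (avoids⇒avoiding π av)

    L<b : All (_< b) L
    L<b = VecAll.toList⁺ l<b

    w≤b : All (_≤ b) (L ++ b ∷ r)
    w≤b = All.++⁺ (All.map <⇒≤ L<b)
      (≤-refl ∷ avoiding-afterAscent L (subst (1 ≤_) (sym (length-toList l)) 1≤i) L<b avL)

    p : L ++ b ∷ r ↭ suc m ∷ S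
    p = subst (_↭ suc m ∷ S) eq (∈-permutations⁻ π π∈)

    -- As a letter of the permutation, `b` is at most `suc m`; as an upper bound of all its letters,
    -- it is at least `suc m`.
    b≡1+m : b ≡ suc m
    b≡1+m = ≤-antisym
      (All.lookup (≤-refl ∷ All.map <⇒≤ S<1+m) (∈-resp-↭ p (∈-++⁺ʳ L (here refl))))
      (All.lookup w≤b (∈-resp-↭ (↭-sym p) (here refl)))

    atMax : b ≡ suc m → L ++ b ∷ r ↭ suc m ∷ S → AvoidersWithMaxAt (suc m) S i (L ++ b ∷ r)
    atMax refl p = subst (λ j → AvoidersWithMaxAt b S j (L ++ b ∷ r)) (length-toList l)
      (avoiders⇒withMaxAt S<1+m S↓ (allPairs-toList⁺ l↓) p avL)

  withMaxAt⇒counted : ∀ {i w} → AvoidersWithMaxAt (suc m) S i w →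
                      ∃ λ (π : Vec ℕ (suc m)) →
                      (π ∈ permutations (suc m) × Avoids12-3 π ×
                       BeginsWith (descendingThenMax (suc i)) π) × w ≡ toList π
  withMaxAt⇒counted {i} {w} at@(L , (L⊆S , |L|) , r , _ , eq)
    with p , av ← withMaxAt⇒avoiders S<1+m S↓ at
    with π , refl ← vecOfLength w (trans (↭-length p) (length-toList (descending (suc m))))
       | l , refl ← vecOfLength L |L| =
    π ,
    (∈-permutations⁺ π p , avoiding⇒avoids π av ,
     -- Being a sublist of `S`, the part before the maximum is descending and below `suc m`, as the
     -- pattern demands.
     beginsWith-descendingThenMax⁺ l i<1+m
       ( allPairs-toList⁻ (AllPairs-resp-⊆ L⊆S S↓)
       , VecAll.toList⁻ (All-resp-⊆ L⊆S S<1+m)) eq) ,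
    refl
    where
    i<1+m : suc i ≤ suc m
    i<1+m = s≤s (begin
      i         ≡⟨ |L| ⟨
      length L  ≤⟨ length-mono-≤ L⊆S ⟩
      length S  ≡⟨ length-toList (descending m) ⟩
      m         ∎)
      where open ≤-Reasoning

  -- The same set of lists is enumerated twice: by the filtered permutations, carried over along the
  -- injective `toList`, and by the choices of `L` and `r` around the maximum.
  N12-3-descendingThenMax : ∀ {i} → 1 ≤ i →
    N12-3 (descendingThenMax (suc i)) (suc m) ≡ (m C i) * bell (m ∸ i)
  N12-3-descendingThenMax {i} 1≤i =
    size-unique
      (size-cong
        (λ { (π , π∈ , refl) →
             let π∈perms , av , begins = ∈-filter⁻ counted? π∈
             in counted⇒withMaxAt π 1≤i π∈perms av begins })
        (λ at → let π , (π∈perms , av , begins) , eq = withMaxAt⇒counted at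
                in π , ∈-filter⁺ counted? π∈perms (av , begins) , eq)
        (size-map toList
          (λ {π} {ρ} eq → trans (sym (cast-is-id refl π)) (toList-injective refl π ρ eq))
          listed))
      (size-subst (cong (λ l → (l C i) * bell (l ∸ i)) (length-toList (descending m)))
        (size-avoidersWithMaxAt S<1+m S↓
          (λ R⊆S → size-avoiders (AllPairs-resp-⊆ R⊆S S↓)) i))
    where
    counted? = λ (π : Vec ℕ (suc m)) →
      avoids12-3? π ×-dec beginsWith? (descendingThenMax (suc i)) π

    listed : (_∈ filter counted? (permutations (suc m)))
             HasSize N12-3 (descendingThenMax (suc i)) (suc m)
    listed = record
      { elements = _
      ; unique   = Unique.filter⁺ counted? (permutations-unique (suc m))
      ; sound    = id
      ; complete = id
      ; size     = refl
      }

-- For k = 1 every permutation begins with the pattern, so the count is `bell n`, which differs from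
-- `bell (n ∸ 1)` from n = 2 on. From k = 2 on, the pattern ends in an ascent.
proposition16 : (k n : ℕ) → 2 ≤ k →
    N12-3 (descendingThenMax k) n ≡ ((n ∸ 1) C (k ∸ 1)) * bell (n ∸ k)
proposition16 (suc (suc i)) zero    2≤k@(s≤s (s≤s _)) =
  -- The empty word has no prefix of length at least 2. On the right, `0 ∸ 1` is 0, and `0 C suc i`
  -- vanishes.
  cong length (filter-none counted?
    (All.universal (λ π (_ , begins) → ≤⇒≯ (proj₁ (beginsWith⁻ 2≤k begins)) z<s) (permutations 0)))
  where
  counted? = λ (π : Vec ℕ 0) →
    avoids12-3? π ×-dec beginsWith? (descendingThenMax (suc (suc i))) π
proposition16 (suc (suc i)) (suc m) (s≤s (s≤s _)) = N12-3-descendingThenMax m z<s
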